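{- Let $\lambda$ be a cardinal with $2^{<\lambda}=\lambda>\omega$. Let $(Y,\mathfrak{M})$ be a $\lambda^+$-Borel space, i.e. $\mathfrak{M}$ is the $\lambda^+$-algebra on $Y$ generated by a $T_0$ topology $\tau$ on $Y$ of weight at most $\lambda$. Then there is no continuous $\lambda^+$-measure on $(Y,\mathfrak{M})$ (where $Y$ carries such a topology $\tau$, and for any choice of positively totally ordered monoid $\mathbb{S}$ with infinitary sum $\mathsf{Sum}$ in which the measure takes its values).
   Context: **Monoids and sums.** A positively totally ordered monoid is $\mathbb{S}=(S,0,+,\leq)$ where $+$ is associative (not necessarily commutative) with neutral element $0$, $\leq$ is a total order, $a\leq b$ and $c\leq d$ imply $a+c\leq b+d$, $0$ is the minimum of $\leq$, and $S\neq\{0\}$. ${}^{<\mathrm{On}}\mathbb{S}$ is the class of all sequences of elements of $S$ of ordinal length; $\mathrm{lh}(s)$ is the length of $s$. An infinitary sum on $\mathbb{S}$ is a partial function $\mathsf{Sum}:{}^{<\mathrm{On}}\mathbb{S}\to\mathbb{S}$ such that: (S1) $\mathsf{Sum}(\emptyset)=0$ and $\mathsf{Sum}(s)=s_0+\dots+s_n$ for every non-empty finite $s=(s_i)_{i\leq n}\in\mathrm{dom}(\mathsf{Sum})$; (S2) (continuity) for all $s\in\mathrm{dom}(\mathsf{Sum})$ of limit length, if $s\restriction\alpha\in\mathrm{dom}(\mathsf{Sum})$ for cofinally many $\alpha<\mathrm{lh}(s)$, then $\mathsf{Sum}(s)=\sup\{\mathsf{Sum}(s\restriction\alpha)\mid\alpha<\mathrm{lh}(s),\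 s\restriction\alpha\in\mathrm{dom}(\mathsf{Sum})\}$. **Measures.** A $\lambda^+$-algebra on $Y$ is a family of subsets of $Y$ closed under complements and under unions and intersections of size at most $\lambda$. Given a topology $\tau$ on $Y$ and a $\lambda^+$-algebra $\mathfrak{M}\supseteq\tau$, a $\lambda^+$-measure on $(Y,\mathfrak{M})$ (with values in $(\mathbb{S},\mathsf{Sum})$) is a partial function $\mu:\mathscr{P}(Y)\to\mathbb{S}$ with $\mathfrak{M}\subseteq\mathrm{dom}(\mu)$ such that: (M1) $\mu(\emptyset)=0$; (M2) $\mu(Y)>0$; (M3) $A\subseteq B$ implies $\mu(A)\leq\mu(B)$ for all $A,B\in\mathfrak{M}$; (M4) for every family $(A_i)_{i<\gamma}$ of pairwise disjoint sets of $\mathfrak{M}$ of length an ordinal $\gamma<\lambda^+$, we have $\langle\mu(A_i)\mid i<\gamma\rangle\in\mathrm{dom}(\mathsf{Sum})$ and $\mu(\bigcup_{i<\gamma}A_i)=\mathsf{Sum}(\langle\mu(A_i)\mid i<\gamma\rangle)$; (M5) for every $x\in Y$ with $\{x\}\in\mathfrak{M}$ and every $\tau$-open local basis $\{A_i\mid i<\gamma\}$ at $x$ with $\gamma<\lambda^+$, $\mu(\{x\})=\inf_{i<\gamma}\mu(A_i)$. It is continuous if $\{x\}\in\mathfrak{M}$ and $\mu(\{x\})=0$ for every $x\in Y$. Here $2^{<\lambda}=\sup\{2^{\theta}\mid\theta<\lambda\text{ a cardinal}\}$. -}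

module Defs where

open import Algebra.Bundles using (Monoid)
open import Algebra.Structures using (IsMonoid)
open import Data.Bool.Base using (Bool)
open import Data.Fin.Base as Fin using (Fin)
open import Data.Nat.Base using (ℕ; suc)
open import Data.Product.Base using (Σ-syntax; ∃-syntax; _×_; _,_)
open import Data.Refinement using (Refinement; value; value-injective)
open import Data.Sum.Base using (_⊎_)
open import Function.Base using (_∘_; _on_; flip)
open import Function.Bundles using (_↣_)
open import Induction.WellFounded using (WellFounded)
open import Level using (Level; _⊔_) renaming (suc to lsuc)
open import Relation.Binary.Bundles using (TotalOrder)
open import Relation.Binary.Core using (Rel; _Preserves₂_⟶_⟶_)
open import Relation.Binary.Definitions using (Minimum; Trichotomous; tri<; tri≈; tri>)
open import Relation.Binary.Morphism.Structures using (IsOrderIsomorphism)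
open import Relation.Binary.PropositionalEquality.Core using (_≡_; _≢_; refl; cong; subst)
open import Relation.Binary.PropositionalEquality.Properties using (isEquivalence)
open import Relation.Binary.Structures using (IsStrictTotalOrder; IsTotalOrder)
open import Relation.Nullary.Negation.Core using (¬_)
open import Relation.Unary using (Pred; _∈_; _∉_; _⊆_; _⊆′_; _≐_; _⊥_; _∩_; ∁; ⋃; ⋂; ｛_｝)
open import Relation.Unary.Polymorphic using (∅; U)

import Algebra.Definitions.RawMonoid as RawMonoidSum
import Relation.Binary.Construct.NonStrictToStrict as ToStrict
import Relation.Binary.Construct.On as On

-- The mathematics takes place in ZFC.  Excluded middle for every type (which,
-- deciding inhabitation with a witness, is also a choice principle) and
-- function extensionality are to be assumed as hypotheses wherever needed.
-- The universe Set ℓ plays the role of the universe of sets: cardinals, spaces,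
-- their subsets and ordinals live there.  Families of subsets and
-- classes of sequences are predicates one universe up.

IsSupremum : ∀ {a r i} {A : Set a} {I : Set i} → Rel A r → (I → A) → A → Set (a ⊔ r ⊔ i)
IsSupremum _≤_ f x = (∀ i → f i ≤ x) × (∀ y → (∀ i → f i ≤ y) → x ≤ y)

IsInfimum : ∀ {a r i} {A : Set a} {I : Set i} → Rel A r → (I → A) → A → Set (a ⊔ r ⊔ i)
IsInfimum _≤_ = IsSupremum (flip _≤_)

-- Cardinals: a type stands for its cardinality.

infix 4 _≲_ _⋦_

_≲_ : ∀ {a b} → Set a → Set b → Set (a ⊔ b)
A ≲ B = A ↣ B

_⋦_ : ∀ {a b} → Set a → Set b → Set (a ⊔ b)
A ⋦ B = A ≲ B × ¬ (B ≲ A)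

-- 2^{<κ} = μ
2^<_≣_ : ∀ {ℓ} → Set ℓ → Set ℓ → Set (lsuc ℓ)
2^<_≣_ {ℓ} κ μ = IsSupremum {I = Σ[ θ ∈ Set ℓ ] θ ⋦ κ} _≲_ (λ (θ , _) → θ → Bool) μ

-- Ordinals: a well-ordered type stands for its order type.  Operations on
-- ordinals and on sequences must therefore be invariant under order
-- isomorphism.

record Ordinal ℓ : Set (lsuc ℓ) where
  infix 4 _<_
  field
    Carrier            : Set ℓ
    _<_                : Rel Carrier ℓ
    isStrictTotalOrder : IsStrictTotalOrder _≡_ _<_
    wellFounded        : WellFounded _<_

  open IsStrictTotalOrder isStrictTotalOrder public using (trans; irrefl; compare)

open Ordinal using () renaming (Carrier to ∣_∣)

-- The proof of j < i is irrelevant, so that elements of the initial segment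
-- are equal as soon as their values are.
initialSegment : ∀ {ℓ} (α : Ordinal ℓ) → ∣ α ∣ → Ordinal ℓ
initialSegment α i = record
  { Carrier            = Segment
  ; _<_                = α._<_ on value
  ; isStrictTotalOrder = record
    { isStrictPartialOrder = record
      { isEquivalence = isEquivalence
      ; irrefl        = α.irrefl ∘ cong value
      ; trans         = α.trans
      ; <-resp-≈      = (λ {x} → subst (λ y → value x α.< value y))
                      , (λ {y} → subst (λ x → value x α.< value y))
      }
    ; compare = compareSegment
    }
  ; wellFounded = On.wellFounded value α.wellFounded
  }
  where
  module α = Ordinal α
  Segment = Refinement ∣ α ∣ (α._< i)

  compareSegment : Trichotomous {A = Segment} _≡_ (α._<_ on value)
  compareSegment j k with α.compare (value j) (value k)
  ... | tri< j<k j≢k k≮j = tri< j<k (j≢k ∘ cong value) k≮j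
  ... | tri≈ j≮k j≡k k≮j = tri≈ j≮k (value-injective j≡k) k≮j
  ... | tri> j≮k j≢k k<j = tri> j≮k (j≢k ∘ cong value) k<j

IsLimit : ∀ {ℓ} → Ordinal ℓ → Set ℓ
IsLimit α = ∣ α ∣ × (∀ i → ∃[ j ] i < j)
  where open Ordinal α using (_<_)

record Sequence {c} ℓ (S : Set c) : Set (c ⊔ lsuc ℓ) where
  field
    lh    : Ordinal ℓ
    entry : ∣ lh ∣ → S

open Sequence

infix 8 _↾_

_↾_ : ∀ {c ℓ} {S : Set c} (s : Sequence ℓ S) → ∣ lh s ∣ → Sequence ℓ S
s ↾ i = record { lh = initialSegment (lh s) i ; entry = entry s ∘ value }

record PosTotallyOrderedMonoid c ℓ₁ ℓ₂ : Set (lsuc (c ⊔ ℓ₁ ⊔ ℓ₂)) where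
  infix  4 _≈_ _≤_
  infixl 6 _+_
  field
    Carrier      : Set c
    _≈_          : Rel Carrier ℓ₁
    _≤_          : Rel Carrier ℓ₂
    _+_          : Carrier → Carrier → Carrier
    0#           : Carrier
    isMonoid     : IsMonoid _≈_ _+_ 0#
    isTotalOrder : IsTotalOrder _≈_ _≤_
    +-mono-≤     : _+_ Preserves₂ _≤_ ⟶ _≤_ ⟶ _≤_
    0-minimum    : Minimum _≤_ 0#
    nontrivial   : ∃[ a ] ¬ (a ≈ 0#)

  monoid : Monoid c ℓ₁
  monoid = record { isMonoid = isMonoid }

  totalOrder : TotalOrder c ℓ₁ ℓ₂
  totalOrder = record { isTotalOrder = isTotalOrder }

  open RawMonoidSum (Monoid.rawMonoid monoid) public using (sum)
  open ToStrict _≈_ _≤_ public using (_<_)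

module _ {c ℓ₁ ℓ₂} (𝕊 : PosTotallyOrderedMonoid c ℓ₁ ℓ₂) where
  open PosTotallyOrderedMonoid 𝕊

  -- Equality of sequences, ordinals being given up to order isomorphism.
  record SameSequence {ℓ} (s t : Sequence ℓ Carrier) : Set (c ⊔ ℓ₁ ⊔ ℓ) where
    field
      to                 : ∣ lh s ∣ → ∣ lh t ∣
      isOrderIsomorphism : IsOrderIsomorphism _≡_ _≡_ (Ordinal._<_ (lh s)) (Ordinal._<_ (lh t)) to
      entries            : ∀ i → entry s i ≈ entry t (to i)

  record InfinitarySum ℓ : Set (c ⊔ ℓ₁ ⊔ ℓ₂ ⊔ lsuc (lsuc ℓ)) where
    field
      dom      : Pred (Sequence ℓ Carrier) (lsuc ℓ)
      Sum      : ∀ s → s ∈ dom → Carrier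
      dom-resp : ∀ {s t} → SameSequence s t → s ∈ dom → t ∈ dom
      Sum-cong : ∀ {s t} → SameSequence s t → (s∈ : s ∈ dom) (t∈ : t ∈ dom) → Sum s s∈ ≈ Sum t t∈

      Sum-empty  : ∀ s → ¬ ∣ lh s ∣ → Σ[ s∈ ∈ s ∈ dom ] Sum s s∈ ≈ 0#
      -- e enumerates s as (sᵢ)_{i ≤ n}
      Sum-finite : ∀ s (s∈ : s ∈ dom) n (e : Fin (suc n) → ∣ lh s ∣) →
                   IsOrderIsomorphism _≡_ _≡_ Fin._<_ (Ordinal._<_ (lh s)) e →
                   Sum s s∈ ≈ sum (entry s ∘ e)
      continuity : ∀ s (s∈ : s ∈ dom) → IsLimit (lh s) →
                   (∀ i → ∃[ j ] ¬ Ordinal._<_ (lh s) j i × s ↾ j ∈ dom) →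
                   IsSupremum {I = Σ[ j ∈ ∣ lh s ∣ ] s ↾ j ∈ dom} _≤_
                     (λ (j , s↾j∈) → Sum (s ↾ j) s↾j∈) (Sum s s∈)

Family : ∀ {ℓ} → Set ℓ → Set (lsuc (lsuc ℓ))
Family {ℓ} Y = Pred (Pred Y ℓ) (lsuc ℓ)

module _ {ℓ} {Y : Set ℓ} where

  -- Subsets are predicates taken up to _≐_.
  Extensional : Family Y → Set (lsuc ℓ)
  Extensional 𝔉 = ∀ {A B} → A ≐ B → A ∈ 𝔉 → B ∈ 𝔉

  -- Unions over index types in Set ℓ are all unions: classically, Pred Y ℓ up
  -- to _≐_ is the type Y → Bool in Set ℓ.
  record IsTopology (τ : Family Y) : Set (lsuc ℓ) where
    field
      resp : Extensional τ
      ∅∈   : ∅ ∈ τ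
      U∈   : U ∈ τ
      ∩∈   : ∀ {A B} → A ∈ τ → B ∈ τ → A ∩ B ∈ τ
      ⋃∈   : ∀ (I : Set ℓ) A → (∀ i → A i ∈ τ) → ⋃ I A ∈ τ

  IsT₀ : Family Y → Set (lsuc ℓ)
  IsT₀ τ = ∀ x y → x ≢ y → ∃[ A ] A ∈ τ × ((x ∈ A × y ∉ A) ⊎ (y ∈ A × x ∉ A))

  IsLocalBasis : Family Y → Y → {I : Set ℓ} → (I → Pred Y ℓ) → Set (lsuc ℓ)
  IsLocalBasis τ x A =
    (∀ i → A i ∈ τ × x ∈ A i) × (∀ V → V ∈ τ → x ∈ V → ∃[ i ] A i ⊆ V)

  IsBasis : Family Y → {I : Set ℓ} → (I → Pred Y ℓ) → Set (lsuc ℓ)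
  IsBasis τ B =
    (∀ i → B i ∈ τ) × (∀ V x → V ∈ τ → x ∈ V → ∃[ i ] x ∈ B i × B i ⊆ V)

  HasWeight≤ : Set ℓ → Family Y → Set (lsuc ℓ)
  HasWeight≤ κ τ = Σ[ I ∈ Set ℓ ] I ≲ κ × Σ[ B ∈ (I → Pred Y ℓ) ] IsBasis τ B

  record IsAlgebra⁺ (κ : Set ℓ) (𝔐 : Family Y) : Set (lsuc ℓ) where
    field
      resp : Extensional 𝔐
      ∁∈   : ∀ {A} → A ∈ 𝔐 → ∁ A ∈ 𝔐
      ⋃∈   : ∀ (I : Set ℓ) → I ≲ κ → ∀ A → (∀ i → A i ∈ 𝔐) → ⋃ I A ∈ 𝔐
      ⋂∈   : ∀ (I : Set ℓ) → I ≲ κ → ∀ A → (∀ i → A i ∈ 𝔐) → ⋂ I A ∈ 𝔐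

  record IsAlgebra⁺GeneratedBy (κ : Set ℓ) (τ 𝔐 : Family Y) : Set (lsuc (lsuc ℓ)) where
    field
      isAlgebra⁺ : IsAlgebra⁺ κ 𝔐
      contains   : τ ⊆′ 𝔐
      least      : ∀ 𝔑 → IsAlgebra⁺ κ 𝔑 → τ ⊆′ 𝔑 → 𝔐 ⊆′ 𝔑

  record IsBorelSpace⁺ (κ : Set ℓ) (τ 𝔐 : Family Y) : Set (lsuc (lsuc ℓ)) where
    field
      isTopology  : IsTopology τ
      isT₀        : IsT₀ τ
      weight≤     : HasWeight≤ κ τ
      isGenerated : IsAlgebra⁺GeneratedBy κ τ 𝔐

    open IsAlgebra⁺GeneratedBy isGenerated public

  -- An ordinal γ satisfies γ < κ⁺ iff ∣ γ ∣ ≲ κ.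
  record Measure⁺ (κ : Set ℓ) {τ 𝔐 : Family Y} (τ⊆𝔐 : τ ⊆′ 𝔐)
                  {c ℓ₁ ℓ₂} (𝕊 : PosTotallyOrderedMonoid c ℓ₁ ℓ₂) (𝕊um : InfinitarySum 𝕊 ℓ)
                  : Set (c ⊔ ℓ₁ ⊔ ℓ₂ ⊔ lsuc (lsuc ℓ)) where
    open PosTotallyOrderedMonoid 𝕊 using (_≈_; _≤_; _<_; 0#) renaming (Carrier to S)
    open InfinitarySum 𝕊um using (Sum) renaming (dom to domSum)
    field
      dom      : Family Y
      μ        : ∀ A → A ∈ dom → S
      dom-resp : Extensional dom
      μ-cong   : ∀ {A B} → A ≐ B → (A∈ : A ∈ dom) (B∈ : B ∈ dom) → μ A A∈ ≈ μ B B∈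
      𝔐⊆dom    : 𝔐 ⊆′ dom

    μ⟨_⟩ : ∀ {A} → A ∈ 𝔐 → S
    μ⟨ A∈ ⟩ = μ _ (𝔐⊆dom _ A∈)

    measures : (γ : Ordinal ℓ) (A : ∣ γ ∣ → Pred Y ℓ) → (∀ i → A i ∈ 𝔐) → Sequence ℓ S
    measures γ A A∈ = record { lh = γ ; entry = λ i → μ⟨ A∈ i ⟩ }

    field
      μ-∅    : Σ[ ∅∈ ∈ ∅ ∈ dom ] μ ∅ ∅∈ ≈ 0#
      μ-U    : Σ[ U∈ ∈ U ∈ dom ] 0# < μ U U∈
      μ-mono : ∀ {A B} (A∈ : A ∈ 𝔐) (B∈ : B ∈ 𝔐) → A ⊆ B → μ⟨ A∈ ⟩ ≤ μ⟨ B∈ ⟩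
      μ-⋃    : ∀ (γ : Ordinal ℓ) → ∣ γ ∣ ≲ κ →
               ∀ A (A∈ : ∀ i → A i ∈ 𝔐) → (∀ i j → i ≢ j → A i ⊥ A j) →
               Σ[ ⋃∈ ∈ ⋃ ∣ γ ∣ A ∈ dom ] Σ[ s∈ ∈ measures γ A A∈ ∈ domSum ]
                 μ (⋃ ∣ γ ∣ A) ⋃∈ ≈ Sum (measures γ A A∈) s∈
      μ-｛｝  : ∀ x (x∈ : ｛ x ｝ ∈ 𝔐) (γ : Ordinal ℓ) → ∣ γ ∣ ≲ κ →
               ∀ (A : ∣ γ ∣ → Pred Y ℓ) (A∈ : ∀ i → A i ∈ τ) → IsLocalBasis τ x A →
               IsInfimum _≤_ (λ i → μ⟨ τ⊆𝔐 _ (A∈ i) ⟩) μ⟨ x∈ ⟩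

    IsContinuous : Set (ℓ₁ ⊔ lsuc ℓ)
    IsContinuous = ∀ x → Σ[ x∈ ∈ ｛ x ｝ ∈ 𝔐 ] μ⟨ x∈ ⟩ ≈ 0#

{-# OPTIONS --safe #-}

-- Call a set small if its measure is below μ(Y), and write "positive" for "of
-- measure > 0".  Continuity of Sum gives, for a union of at most κ sets, that its
-- measure is bounded by any bound on the finite subunions; hence null sets are
-- closed under such unions.  By (M5), Y is covered for each η > 0 by at most κ
-- basic open sets of measure < η.  So if nη ≤ μ(Z) for all n, then μ(Y) ≤ μ(Z):
-- for small Z some multiple nη exceeds μ(Z), and Z is "archimedean".
--
-- Fix a small positive Z.  Cutting off ever smaller positive parts of Z leaves
-- positive differences whose measures εₖ are coinitial in the positive values.
-- Given a cover of Z by sets of measure < εₖ, for each l a greedy choice of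
-- finitely many of its members leaves less than εₗ of every other member, so
-- countably many members cover Z up to a null set.  All these members, over all k,
-- form a countable family.  Each atom of that family is null: for every k it lies
-- inside a set of measure < εₖ or inside a null set.  As there are at most
-- 2^ω ≤ κ atoms, Z is null, a contradiction.

module Submission where

open import Algebra.Bundles using (Monoid)
open import Algebra.Structures using (IsMonoid)
open import Axiom.ExcludedMiddle using (ExcludedMiddle)
open import Axiom.Extensionality.Propositional using (Extensionality)
open import Data.Bool.Base using (Bool; true; false)
open import Data.Empty using (⊥-elim)
open import Data.Fin.Base as Fin using (Fin; toℕ)
open import Data.Fin.Induction using (<-wellFounded)
open import Data.Fin.Patterns using (0F; 1F)
open import Data.Fin.Properties using (toℕ-injective; <-cmp; <-trans; <-irrefl)
open import Data.Irrelevant using ([_])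
open import Data.List.Base using (List; []; _∷_; length)
open import Data.Maybe.Base using (Maybe; just; nothing)
open import Data.Maybe.Properties using (just-injective)
open import Data.Nat.Base using (ℕ; zero; suc; _*_)
open import Data.Nat.Properties using (even≢odd; *-cancelˡ-≡; suc-injective)
open import Data.Product.Base using (Σ-syntax; ∃-syntax; _×_; _,_; proj₁; proj₂; swap)
open import Data.Refinement using (value; value-injective; _,_)
open import Data.Sum.Base using (_⊎_; inj₁; inj₂; [_,_]′)
open import Function.Base using (_∘_; id; case_of_)
open import Function.Bundles using (mk↣; mk⇔)
open import Function.Construct.Composition using (_↣-∘_)
open import Induction.WellFounded using (WellFounded; Acc; acc)
open import Level using (Lift; lift; lower; _⊔_) renaming (suc to lsuc)
open import Relation.Binary.Core using (Rel)
open import Relation.Binary.Definitions using (Trichotomous; tri<; tri≈; tri>)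
open import Relation.Binary.Morphism.Structures using (IsOrderIsomorphism)
open import Relation.Binary.PropositionalEquality.Core using (_≡_; _≢_; refl; sym; trans; cong; subst)
open import Relation.Binary.PropositionalEquality.Properties using (isEquivalence)
open import Relation.Binary.Structures using (IsTotalOrder)
open import Relation.Nullary.Decidable
  using (yes; no; does; decidable-stable; dec-false; dec-true; does-⇔; recompute)
open import Relation.Nullary.Negation.Core using (¬_; contradiction)
open import Relation.Unary using (Pred; _∈_; _∉_; _⊆_; _≐_; _⊥_; _∪_; _∩_; ∁; ⋃; ⋂)
open import Relation.Unary.Polymorphic using (∅; U)
open import Defs

import Algebra.Definitions.RawMonoid as RawMonoid

open Ordinal using () renaming (Carrier to ∣_∣)

-- Zermelo's well-ordering theorem.

module Zermelo (em : ∀ {a} → ExcludedMiddle a) (ext : ∀ {a b} → Extensionality a b)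
               {ℓ} (I : Set ℓ) where

  -- Deciding an existential by `em` returns a witness, which serves as the choice.
  choose : (I → Bool) → Maybe I
  choose f with em {P = ∃[ i ] f i ≡ false}
  ... | yes (i , _) = just i
  ... | no _        = nothing

  choose-just : ∀ f {i} → choose f ≡ just i → f i ≡ false
  choose-just f eq with em {P = ∃[ i ] f i ≡ false}
  choose-just f refl | yes (_ , fi) = fi

  choose-nothing : ∀ f {i} → choose f ≡ nothing → ¬ f i ≡ false
  choose-nothing f eq fi with em {P = ∃[ i ] f i ≡ false}
  choose-nothing f () fi | yes _
  ... | no none = none (_ , fi)

  -- Sets are turned into characteristic functions so that the chosen element
  -- depends only on their extension.
  choose∉ : Pred I ℓ → Maybe I
  choose∉ P = choose (λ i → does (em {P = i ∈ P}))

  choose∉-just : ∀ P {i} → choose∉ P ≡ just i → i ∉ P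
  choose∉-just P eq i∈P = case trans (sym (dec-true em i∈P)) (choose-just _ eq) of λ ()

  choose∉-nothing : ∀ P {i} → choose∉ P ≡ nothing → ¬ i ∉ P
  choose∉-nothing P eq i∉P = choose-nothing _ eq (dec-false em i∉P)

  choose∉-cong : ∀ {P Q} → P ⊆ Q → Q ⊆ P → choose∉ P ≡ choose∉ Q
  choose∉-cong P⊆Q Q⊆P = cong choose (ext (λ i → does-⇔ (mk⇔ P⊆Q Q⊆P) em em))

  -- Zermelo's construction: a stage is a subset of I obtained by transfinitely
  -- many choices of a new element, and i ≺ j when i enters before j.
  data Stage : Set (lsuc ℓ) where
    stage : (J : Set ℓ) → (J → Stage) → Stage

  ⟦_⟧ ⟦_⟧⁺ : Stage → Pred I ℓ
  ⟦ stage J F ⟧ i = ∃[ j ] i ∈ ⟦ F j ⟧⁺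
  ⟦ v ⟧⁺ i = i ∈ ⟦ v ⟧ ⊎ choose∉ ⟦ v ⟧ ≡ just i

  comparable : ∀ v w → ⟦ v ⟧ ⊆ ⟦ w ⟧ ⊎ ⟦ w ⟧⁺ ⊆ ⟦ v ⟧
  comparable (stage J F) w with em {P = ∃[ j ] ¬ (⟦ F j ⟧⁺ ⊆ ⟦ w ⟧)}
  ... | no all = inj₁ λ (j , i∈) → decidable-stable em (λ ¬p → all (j , λ s → ¬p (s i∈)))
  ... | yes (j , ¬s) with comparable (F j) w | comparable w (F j)
  ... | inj₂ w⁺⊆ | _        = inj₂ λ i∈ → j , inj₁ (w⁺⊆ i∈)
  ... | inj₁ _   | inj₂ ⊆w  = ⊥-elim (¬s ⊆w)
  ... | inj₁ ⊆w  | inj₁ w⊆  = inj₂ λ where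
    (inj₁ i∈) → j , inj₁ (w⊆ i∈)
    (inj₂ eq) → j , inj₂ (trans (choose∉-cong ⊆w w⊆) eq)

  Avoids : I → Stage → Pred I ℓ
  Avoids i w k = i ∉ ⟦ w ⟧⁺ × choose∉ ⟦ w ⟧ ≡ just k

  -- Passing through the decision keeps the set of all k that enter before i in Set ℓ.
  Before : I → Set ℓ
  Before i = Σ[ k ∈ I ] does (em {P = Σ[ w ∈ Stage ] Avoids i w k}) ≡ true

  stage-of : ∀ {i} (k : Before i) → Σ[ w ∈ Stage ] Avoids i w (proj₁ k)
  stage-of {i} (k , eq) with em {P = Σ[ w ∈ Stage ] Avoids i w k}
  ... | yes p = p

  -- The moment just before `i` is chosen: one stage still missing `i` is collected for every
  -- element that enters earlier.
  birth : I → Stage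
  birth i = stage (Before i) (proj₁ ∘ stage-of)

  ∉birth : ∀ i → i ∉ ⟦ birth i ⟧
  ∉birth i (k , i∈) = proj₁ (proj₂ (stage-of k)) i∈

  -- If some `k` other than `i` came next, `birth i` itself would show that `k` enters before `i`,
  -- so `k` would already be present.
  choose∉-birth : ∀ i → choose∉ ⟦ birth i ⟧ ≡ just i
  choose∉-birth i with choose∉ ⟦ birth i ⟧ in eq
  ... | nothing = ⊥-elim (choose∉-nothing _ eq (∉birth i))
  ... | just k with em {P = i ≡ k}
  ...   | yes i≡k = cong just (sym i≡k)
  ...   | no i≢k  = ⊥-elim (choose∉-just _ eq (early , inj₂ (proj₂ (proj₂ (stage-of early)))))
    where
    early : Before i
    early = k , dec-true em (birth i , (λ where
      (inj₁ i∈)  → ∉birth i i∈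
      (inj₂ eq′) → i≢k (just-injective (trans (sym eq′) eq))) , eq)

  infix 4 _≺_

  _≺_ : Rel I ℓ
  j ≺ i = j ∈ ⟦ birth i ⟧

  birth∈⁺ : ∀ {i} → i ∈ ⟦ birth i ⟧⁺
  birth∈⁺ = inj₂ (choose∉-birth _)

  birth-⊆ : ∀ v {i} → i ∈ ⟦ v ⟧ → ⟦ birth i ⟧ ⊆ ⟦ v ⟧
  birth-⊆ v i∈ with comparable (birth _) v
  ... | inj₁ ⊆v  = ⊆v
  ... | inj₂ v⁺⊆ = ⊥-elim (∉birth _ (v⁺⊆ (inj₁ i∈)))

  ≺-trans : ∀ {i j k} → i ≺ j → j ≺ k → i ≺ k
  ≺-trans i≺j j≺k = birth-⊆ (birth _) j≺k i≺j

  ≺-irrefl : ∀ {i j} → i ≡ j → ¬ i ≺ j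
  ≺-irrefl refl = ∉birth _

  ≺-compare : Trichotomous _≡_ _≺_
  ≺-compare i j with comparable (birth i) (birth j) | comparable (birth j) (birth i)
  ... | inj₂ j⁺⊆ | _        = tri> (≺-irrefl refl ∘ ≺-trans j≺i) (λ eq → ≺-irrefl (sym eq) j≺i) j≺i
    where j≺i = j⁺⊆ birth∈⁺
  ... | inj₁ _   | inj₂ i⁺⊆ = tri< i≺j (λ eq → ≺-irrefl eq i≺j) (≺-irrefl refl ∘ ≺-trans i≺j)
    where i≺j = i⁺⊆ birth∈⁺
  ... | inj₁ i⊆j | inj₁ j⊆i = tri≈ (∉birth i ∘ j⊆i) i≡j (∉birth j ∘ i⊆j)
    where
    i≡j = just-injective (trans (sym (choose∉-birth i))
            (trans (choose∉-cong i⊆j j⊆i) (choose∉-birth j)))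

  -- Induction on the stage: everything that precedes the element chosen at `F j` already lies in
  -- `F j`.
  stage-acc : ∀ v {i} → i ∈ ⟦ v ⟧ → Acc _≺_ i
  stage-acc (stage J F) (j , inj₁ i∈) = stage-acc (F j) i∈
  stage-acc (stage J F) {i} (j , inj₂ eq) = acc λ k≺i → stage-acc (F j) (birth⊆Fj k≺i)
    where
    birth⊆Fj : ⟦ birth i ⟧ ⊆ ⟦ F j ⟧
    birth⊆Fj with comparable (birth i) (F j)
    ... | inj₁ ⊆Fj = ⊆Fj
    ... | inj₂ ⁺⊆  = ⊥-elim (∉birth i (⁺⊆ (inj₂ eq)))

  ≺-wellFounded : WellFounded _≺_
  ≺-wellFounded i = acc (stage-acc (birth i))

  wellOrder : Ordinal ℓ
  wellOrder = record
    { Carrier            = I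
    ; _<_                = _≺_
    ; isStrictTotalOrder = record
      { isStrictPartialOrder = record
        { isEquivalence = isEquivalence
        ; irrefl        = ≺-irrefl
        ; trans         = ≺-trans
        ; <-resp-≈      = (λ {x} → subst (x ≺_)) , (λ {y} → subst (_≺ y))
        }
      ; compare = ≺-compare
      }
    ; wellFounded = ≺-wellFounded
    }

-- A two-element ordinal and a coding of triples of numbers.

two : ∀ ℓ → Ordinal ℓ
two ℓ = record
  { Carrier            = Lift ℓ (Fin 2)
  ; _<_                = λ i j → Lift ℓ (lower i Fin.< lower j)
  ; isStrictTotalOrder = record
    { isStrictPartialOrder = record
      { isEquivalence = isEquivalence
      ; irrefl        = λ { refl (lift i<i) → <-irrefl refl i<i }
      ; trans         = λ (lift p) (lift q) → lift (<-trans p q)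
      ; <-resp-≈      = (λ { refl p → p }) , (λ { refl p → p })
      }
    ; compare = compare
    }
  ; wellFounded = λ i → accessible (<-wellFounded (lower i))
  }
  where
  compare : Trichotomous {A = Lift ℓ (Fin 2)} _≡_ (λ i j → Lift ℓ (lower i Fin.< lower j))
  compare (lift i) (lift j) with <-cmp i j
  ... | tri< p q r = tri< (lift p) (q ∘ cong lower) (r ∘ lower)
  ... | tri≈ p q r = tri≈ (p ∘ lower) (cong lift q) (r ∘ lower)
  ... | tri> p q r = tri> (p ∘ lower) (q ∘ cong lower) (lift r)

  accessible : ∀ {i} → Acc Fin._<_ i → Acc (λ i j → Lift ℓ (lower i Fin.< lower j)) (lift i)
  accessible (acc rs) = acc λ (lift p) → accessible (rs p)

-- This is 2^a (2b + 1).
encode : ℕ → ℕ → ℕ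
encode zero    b = suc (2 * b)
encode (suc a) b = 2 * encode a b

encode-injective : ∀ a b {a′ b′} → encode a b ≡ encode a′ b′ → a ≡ a′ × b ≡ b′
encode-injective zero    b {zero}   {b′} eq = refl , *-cancelˡ-≡ b b′ 2 (suc-injective eq)
encode-injective zero    b {suc a′} {b′} eq = ⊥-elim (even≢odd (encode a′ b′) b (sym eq))
encode-injective (suc a) b {zero}   {b′} eq = ⊥-elim (even≢odd (encode a b) b′ eq)
encode-injective (suc a) b {suc a′} {b′} eq
  with encode-injective a b {a′} {b′} (*-cancelˡ-≡ (encode a b) (encode a′ b′) 2 eq)
... | a≡a′ , b≡b′ = cong suc a≡a′ , b≡b′

ℕ³≲ℕ : ∀ {ℓ} → Lift ℓ (ℕ × ℕ × ℕ) ≲ ℕ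
ℕ³≲ℕ = mk↣ {to = λ (lift (a , b , c)) → encode a (encode b c)} injective
  where
  injective : ∀ {x y} → _ → x ≡ y
  injective {lift (a , b , c)} {lift (a′ , b′ , c′)} eq with encode-injective a _ {a′} eq
  ... | refl , eq′ with encode-injective b c {b′} {c′} eq′
  ...   | refl , refl = refl

-- Measurable sets and finite additivity.

module Measure
  (em : ∀ {a} → ExcludedMiddle a) (ext : ∀ {a b} → Extensionality a b)
  {ℓ c ℓ₁ ℓ₂} {κ : Set ℓ} (ℕ≲κ : ℕ ≲ κ)
  {Y : Set ℓ} {τ 𝔐 : Family Y} (borel : IsBorelSpace⁺ κ τ 𝔐)
  {𝕊 : PosTotallyOrderedMonoid c ℓ₁ ℓ₂} {𝕊um : InfinitarySum 𝕊 ℓ}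
  (m : Measure⁺ κ (IsBorelSpace⁺.contains borel) 𝕊 𝕊um)
  where

  open PosTotallyOrderedMonoid 𝕊 hiding (_<_)
  open IsTotalOrder isTotalOrder using (total; reflexive; antisym; module Eq)
    renaming (refl to ≤-refl; trans to ≤-trans)
  open IsMonoid isMonoid using (identityˡ; identityʳ; ∙-cong)
  open RawMonoid (Monoid.rawMonoid monoid) using () renaming (_×_ to _·_)
  open InfinitarySum 𝕊um using (Sum-cong; Sum-finite; continuity)
  open IsBorelSpace⁺ borel using (isTopology; weight≤; isAlgebra⁺; contains)
  open IsTopology isTopology using (∅∈; U∈)
  open IsAlgebra⁺ isAlgebra⁺ using (resp; ∁∈; ⋃∈; ⋂∈)
  open Measure⁺ m using (μ; μ-cong; μ⟨_⟩; μ-∅; μ-U; μ-mono; μ-⋃; μ-｛｝)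

  dne : ∀ {a} {P : Set a} → ¬ ¬ P → P
  dne = decidable-stable em

  ≰⇒≤ : ∀ {a b} → ¬ a ≤ b → b ≤ a
  ≰⇒≤ {a} {b} a≰b = [ (λ a≤b → contradiction a≤b a≰b) , id ]′ (total a b)

  Measurable : Set (lsuc ℓ)
  Measurable = Σ[ A ∈ Pred Y ℓ ] A ∈ 𝔐

  infix 4 _∈ₛ_ _⊆ₛ_
  infixr 6 _∪ₛ_ _∩ₛ_ _∖ₛ_

  _∈ₛ_ : Y → Measurable → Set ℓ
  x ∈ₛ A = x ∈ proj₁ A

  _⊆ₛ_ : Measurable → Measurable → Set ℓ
  A ⊆ₛ B = proj₁ A ⊆ proj₁ B

  ∅ₛ Uₛ : Measurable
  ∅ₛ = ∅ , contains _ ∅∈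
  Uₛ = U , contains _ U∈

  ∁ₛ : Measurable → Measurable
  ∁ₛ (A , A∈) = ∁ A , ∁∈ A∈

  ⋃ₛ : {I : Set ℓ} → I ≲ κ → (I → Measurable) → Measurable
  ⋃ₛ {I} I≲κ A = ⋃ I (proj₁ ∘ A) , ⋃∈ I I≲κ _ (proj₂ ∘ A)

  ⋂ₛ : {I : Set ℓ} → I ≲ κ → (I → Measurable) → Measurable
  ⋂ₛ {I} I≲κ A = ⋂ I (proj₁ ∘ A) , ⋂∈ I I≲κ _ (proj₂ ∘ A)

  2≲κ : Lift ℓ (Fin 2) ≲ κ
  2≲κ = ℕ≲κ ↣-∘ mk↣ {to = toℕ ∘ lower} (cong lift ∘ toℕ-injective)

  pair : Measurable → Measurable → Lift ℓ (Fin 2) → Measurable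
  pair A B (lift 0F) = A
  pair A B (lift 1F) = B

  pair-≐ : ∀ A B → ⋃ (Lift ℓ (Fin 2)) (proj₁ ∘ pair A B) ≐ proj₁ A ∪ proj₁ B
  pair-≐ A B = (λ { (lift 0F , x∈) → inj₁ x∈ ; (lift 1F , x∈) → inj₂ x∈ })
             , [ lift 0F ,_ , lift 1F ,_ ]′

  abstract
    ∪∈ : (A B : Measurable) → proj₁ A ∪ proj₁ B ∈ 𝔐
    ∪∈ A B = resp (pair-≐ A B) (⋃∈ _ 2≲κ _ (proj₂ ∘ pair A B))

    ∩∈ : (A B : Measurable) → proj₁ A ∩ proj₁ B ∈ 𝔐
    ∩∈ A B = resp
      ( (λ x∉ → dne (λ x∉A → x∉ (inj₁ x∉A)) , dne (λ x∉B → x∉ (inj₂ x∉B)))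
      , (λ (x∈A , x∈B) → [ (λ x∉A → x∉A x∈A) , (λ x∉B → x∉B x∈B) ]′) )
      (∁∈ (∪∈ (∁ₛ A) (∁ₛ B)))

  _∪ₛ_ _∩ₛ_ _∖ₛ_ : Measurable → Measurable → Measurable
  A ∪ₛ B = proj₁ A ∪ proj₁ B , ∪∈ A B
  A ∩ₛ B = proj₁ A ∩ proj₁ B , ∩∈ A B
  A ∖ₛ B = A ∩ₛ ∁ₛ B

  vol : Measurable → Carrier
  vol (A , A∈) = μ⟨ A∈ ⟩

  vol-mono : ∀ {A B} → A ⊆ₛ B → vol A ≤ vol B
  vol-mono {_ , A∈} {_ , B∈} = μ-mono A∈ B∈

  vol-∅ : vol ∅ₛ ≤ 0#
  vol-∅ = reflexive (Eq.trans (μ-cong (id , id) _ _) (proj₂ μ-∅))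

  vol-U : ¬ vol Uₛ ≤ 0#
  vol-U U≤0 = proj₂ 0<U (Eq.trans (antisym (0-minimum _) U≤0) (μ-cong (id , id) _ _))
    where 0<U = proj₂ μ-U

  vol-disjoint : ∀ A B → proj₁ A ⊥ proj₁ B → vol (A ∪ₛ B) ≈ vol A + vol B
  vol-disjoint A B A⊥B = Eq.trans (μ-cong (swap (pair-≐ A B)) _ _) (Eq.trans (proj₂ (proj₂ sum₂))
    -- The 1 stands for two entries; `sum` ends in `0#`, which `identityʳ` removes.
    (Eq.trans (Sum-finite _ _ 1 lift lift-iso) (∙-cong Eq.refl (identityʳ _))))
    where
    disjoint : ∀ i j → i ≢ j → proj₁ (pair A B i) ⊥ proj₁ (pair A B j)
    disjoint (lift 0F) (lift 0F) i≢j _ = ⊥-elim (i≢j refl)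
    disjoint (lift 0F) (lift 1F) _ (x∈A , x∈B) = A⊥B (x∈A , x∈B)
    disjoint (lift 1F) (lift 0F) _ (x∈B , x∈A) = A⊥B (x∈A , x∈B)
    disjoint (lift 1F) (lift 1F) i≢j _ = ⊥-elim (i≢j refl)
    sum₂ = μ-⋃ (two ℓ) 2≲κ (proj₁ ∘ pair A B) (proj₂ ∘ pair A B) disjoint
    lift-iso : IsOrderIsomorphism _≡_ _≡_ Fin._<_ (Ordinal._<_ (two ℓ)) lift
    lift-iso = record
      { isOrderMonomorphism = record
        { isOrderHomomorphism = record { cong = cong lift ; mono = lift }
        ; injective           = cong lower
        ; cancel              = lower
        }
      ; surjective = λ (lift i) → i , λ { refl → refl }
      }

  vol-superadditive : ∀ {A B C} → proj₁ A ⊥ proj₁ B → A ⊆ₛ C → B ⊆ₛ C → vol A + vol B ≤ vol C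
  vol-superadditive {A} {B} A⊥B A⊆C B⊆C =
    ≤-trans (reflexive (Eq.sym (vol-disjoint A B A⊥B))) (vol-mono {A ∪ₛ B} [ A⊆C , B⊆C ]′)

  vol-subadditive : ∀ {A B C} → C ⊆ₛ A ∪ₛ B → vol C ≤ vol A + vol B
  vol-subadditive {A} {B} {C} C⊆ = ≤-trans (vol-mono C⊆A⊔B) (≤-trans
    (reflexive (vol-disjoint A (B ∖ₛ A) λ (x∈A , _ , x∉A) → x∉A x∈A))
    (+-mono-≤ ≤-refl (vol-mono {B ∖ₛ A} {B} proj₁)))
    where
    C⊆A⊔B : C ⊆ₛ A ∪ₛ (B ∖ₛ A)
    C⊆A⊔B {x} x∈C with em {P = x ∈ₛ A} | C⊆ x∈C
    ... | yes x∈A | _        = inj₁ x∈A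
    ... | no x∉A  | inj₁ x∈A = ⊥-elim (x∉A x∈A)
    ... | no x∉A  | inj₂ x∈B = inj₂ (x∈B , x∉A)

  -- Increasing unions along an ordinal.

  segment-≲ : ∀ {γ : Ordinal ℓ} → ∣ γ ∣ ≲ κ → ∀ i → ∣ initialSegment γ i ∣ ≲ κ
  segment-≲ γ≲κ i = γ≲κ ↣-∘ mk↣ {to = value} value-injective

  ⋃< : ∀ {γ : Ordinal ℓ} → ∣ γ ∣ ≲ κ → (∣ γ ∣ → Measurable) → ∣ γ ∣ → Measurable
  ⋃< {γ} γ≲κ A i = ⋃ₛ (segment-≲ {γ} γ≲κ i) (A ∘ value)

  ⋃<-intro : ∀ {γ : Ordinal ℓ} (γ≲κ : ∣ γ ∣ ≲ κ) A {i j x} →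
             Ordinal._<_ γ j i → x ∈ₛ A j → x ∈ₛ ⋃< {γ} γ≲κ A i
  ⋃<-intro _ A j<i x∈ = (_ , [ j<i ]) , x∈

  ⋃<-elim : ∀ {γ : Ordinal ℓ} (γ≲κ : ∣ γ ∣ ≲ κ) A {i x} →
            x ∈ₛ ⋃< {γ} γ≲κ A i → ∃[ j ] Ordinal._<_ γ j i × x ∈ₛ A j
  -- Segments store `j < i` irrelevantly; excluded middle recovers a usable proof.
  ⋃<-elim _ A ((j , [ j<i ]) , x∈) = j , recompute em j<i , x∈

  module _ (γ : Ordinal ℓ) (γ≲κ : ∣ γ ∣ ≲ κ) (A : ∣ γ ∣ → Measurable) where
    open Ordinal γ using (_<_; irrefl; compare; wellFounded)

    disjointed : ∣ γ ∣ → Measurable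
    disjointed i = A i ∖ₛ ⋃< {γ} γ≲κ A i

    disjointed-⊥ : ∀ i j → i ≢ j → proj₁ (disjointed i) ⊥ proj₁ (disjointed j)
    disjointed-⊥ i j i≢j ((x∈i , x∉<i) , (x∈j , x∉<j)) with compare i j
    ... | tri< i<j _ _ = x∉<j (⋃<-intro {γ} γ≲κ A i<j x∈i)
    ... | tri≈ _ i≡j _ = i≢j i≡j
    ... | tri> _ _ j<i = x∉<i (⋃<-intro {γ} γ≲κ A j<i x∈j)

    -- Descent stops at the least index whose set contains `x`.
    ⊆⋃-disjointed : ∀ {i x} → Acc _<_ i → x ∈ₛ A i → ∃[ j ] x ∈ₛ disjointed j
    ⊆⋃-disjointed {i} {x} (acc rs) x∈ with em {P = x ∈ₛ ⋃< {γ} γ≲κ A i}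
    ... | no x∉ = i , x∈ , x∉
    ... | yes x∈< with ⋃<-elim {γ} γ≲κ A x∈<
    ...   | j , j<i , x∈j = ⊆⋃-disjointed (rs j<i) x∈j

    -- At limit length, (M4) for the disjointed pieces and (S2) give a supremum over initial
    -- segments, and the pieces before `j` lie inside `A j`. Without a limit the union is empty or
    -- equals its last set.
    vol-⋃-chain : (∀ {i j} → i < j → A i ⊆ₛ A j) → ∀ {y} → (∀ i → vol (A i) ≤ y) →
                  vol (⋃ₛ γ≲κ A) ≤ y
    vol-⋃-chain mono {y} bound with em {P = ∣ γ ∣} | em {P = ∃[ k ] ∀ j → ¬ k < j}
    ... | no empty | _ =
        ≤-trans (vol-mono {⋃ₛ γ≲κ A} {∅ₛ} λ (i , _) → ⊥-elim (empty i)) (≤-trans vol-∅ (0-minimum y))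
    ... | yes _ | yes (k , top) = ≤-trans (vol-mono {⋃ₛ γ≲κ A} {A k} below) (bound k)
      where
      below : ⋃ₛ γ≲κ A ⊆ₛ A k
      below (i , x∈) with compare i k
      ... | tri< i<k _ _  = mono i<k x∈
      ... | tri≈ _ refl _ = x∈
      ... | tri> _ _ k<i  = ⊥-elim (top i k<i)
    ... | yes i₀ | no no-top =
        ≤-trans (vol-mono {⋃ₛ γ≲κ A} {⋃ₛ γ≲κ disjointed}
                  λ (i , x∈) → ⊆⋃-disjointed (wellFounded i) x∈)
        (≤-trans (reflexive (Eq.trans (μ-cong (id , id) _ _) (proj₂ (proj₂ whole))))
        (proj₂ (continuity _ (proj₁ (proj₂ whole)) limit cofinal) y λ (j , s∈) →
          ≤-trans (reflexive (Eq.trans (Sum-cong same s∈ _) (Eq.sym (proj₂ (proj₂ (prefix j))))))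
          (≤-trans (μ-prefix j) (bound j))))
      where
      limit : IsLimit γ
      limit = i₀ , λ i → dne λ none → no-top (i , λ j i<j → none (j , i<j))
      whole = μ-⋃ γ γ≲κ (proj₁ ∘ disjointed) (proj₂ ∘ disjointed) disjointed-⊥
      prefix = λ j → μ-⋃ (initialSegment γ j) (segment-≲ {γ} γ≲κ j)
        (proj₁ ∘ disjointed ∘ value) (proj₂ ∘ disjointed ∘ value)
        λ i k i≢k → disjointed-⊥ (value i) (value k) (i≢k ∘ value-injective)
      cofinal : ∀ i → ∃[ j ] ¬ j < i × _
      cofinal i = i , irrefl refl , proj₁ (proj₂ (prefix i))
      disjointed⊆ : ∀ j → ⋃< {γ} γ≲κ disjointed j ⊆ₛ A j
      disjointed⊆ j x∈ with ⋃<-elim {γ} γ≲κ disjointed x∈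
      ... | k , k<j , (x∈k , _) = mono k<j x∈k
      μ-prefix : ∀ j → μ _ (proj₁ (prefix j)) ≤ vol (A j)
      μ-prefix j = ≤-trans (reflexive (μ-cong (id , id) _ _))
        (vol-mono {⋃< {γ} γ≲κ disjointed j} {A j} (disjointed⊆ j))
      -- `Sum-cong` along the identity reconciles different proofs of membership in the domain.
      same : ∀ {s} → SameSequence 𝕊 {ℓ} s s
      same = record
        { to = id
        ; isOrderIsomorphism = record
          { isOrderMonomorphism = record
            { isOrderHomomorphism = record { cong = id ; mono = id }
            ; injective = id ; cancel = id }
          ; surjective = λ i → i , id }
        ; entries = λ _ → Eq.refl
        }

  -- From finite unions to unions of size at most `κ`; null sets.

  ⋃ₗ : {I : Set ℓ} → (I → Measurable) → List I → Measurable
  ⋃ₗ A []      = ∅ₛ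
  ⋃ₗ A (i ∷ F) = A i ∪ₛ ⋃ₗ A F

  module FiniteUnions {I : Set ℓ} (I≲κ : I ≲ κ) (A : I → Measurable) {y : Carrier} where
    private
      γ : Ordinal ℓ
      γ = Zermelo.wellOrder em ext I
    open Ordinal γ using (_<_; wellFounded) renaming (trans to <-transitive)

    below : I → Measurable
    below = ⋃< {γ} I≲κ A

    -- The set C lets the induction hypothesis for j < i absorb the last member of the family.
    vol-∪-below : ∀ C → (∀ F → vol (C ∪ₛ ⋃ₗ A F) ≤ y) → ∀ {i} → Acc _<_ i →
                  vol (C ∪ₛ below i) ≤ y
    vol-∪-below C bound {i} (acc rs) with em {P = ∃[ j ] j < i}
    ... | no none = ≤-trans (vol-mono {C ∪ₛ below i} {C ∪ₛ ∅ₛ} only-C) (bound [])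
      where
      only-C : C ∪ₛ below i ⊆ₛ C ∪ₛ ∅ₛ
      only-C (inj₁ x∈C) = inj₁ x∈C
      only-C (inj₂ x∈)  = ⊥-elim (none (_ , proj₁ (proj₂ (⋃<-elim {γ} I≲κ A x∈))))
    ... | yes (j₀ , j₀<i) = ≤-trans
        (vol-mono {C ∪ₛ below i} {⋃ₛ (segment-≲ {γ} I≲κ i) B} ⊆B)
        (vol-⋃-chain (initialSegment γ i) (segment-≲ {γ} I≲κ i) B
          (λ {j} {k} → B-mono {j} {k}) vol-B)
      where
      B : ∣ initialSegment γ i ∣ → Measurable
      B (j , _) = (C ∪ₛ A j) ∪ₛ below j
      ⊆B : C ∪ₛ below i ⊆ₛ ⋃ₛ (segment-≲ {γ} I≲κ i) B
      -- `C` is part of every `B j`, so any predecessor of `i` serves; hence the separate case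
      -- without one.
      ⊆B (inj₁ x∈C)               = (j₀ , [ j₀<i ]) , inj₁ (inj₁ x∈C)
      ⊆B (inj₂ ((j , j<i) , x∈j)) = (j , j<i) , inj₁ (inj₂ x∈j)
      B-mono : ∀ {j k} → value j < value k → B j ⊆ₛ B k
      B-mono j<k (inj₁ (inj₁ x∈C)) = inj₁ (inj₁ x∈C)
      B-mono j<k (inj₁ (inj₂ x∈j)) = inj₂ (⋃<-intro {γ} I≲κ A j<k x∈j)
      B-mono j<k (inj₂ x∈) with ⋃<-elim {γ} I≲κ A x∈
      ... | l , l<j , x∈l = inj₂ (⋃<-intro {γ} I≲κ A (<-transitive l<j j<k) x∈l)
      vol-B : ∀ j → vol (B j) ≤ y
      vol-B (j , [ j<i ]) = vol-∪-below (C ∪ₛ A j)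
        (λ F → ≤-trans (vol-mono {(C ∪ₛ A j) ∪ₛ ⋃ₗ A F} {C ∪ₛ ⋃ₗ A (j ∷ F)}
                          [ [ inj₁ , inj₂ ∘ inj₁ ]′ , inj₂ ∘ inj₂ ]′)
                       (bound (j ∷ F)))
        (rs (recompute em j<i))

    -- The unions up to and including `i` form a chain, each bounded by `vol-∪-below` with `C` taken
    -- as `A i`.
    vol-⋃≤ : (∀ F → vol (⋃ₗ A F) ≤ y) → vol (⋃ₛ I≲κ A) ≤ y
    vol-⋃≤ bound = ≤-trans (vol-mono {⋃ₛ I≲κ A} {⋃ₛ I≲κ B} (λ (i , x∈) → i , inj₁ x∈))
      (vol-⋃-chain γ I≲κ B B-mono vol-B)
      where
      B : I → Measurable
      B i = A i ∪ₛ below i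
      B-mono : ∀ {i j} → i < j → B i ⊆ₛ B j
      B-mono i<j (inj₁ x∈i) = inj₂ (⋃<-intro {γ} I≲κ A i<j x∈i)
      B-mono i<j (inj₂ x∈) with ⋃<-elim {γ} I≲κ A x∈
      ... | l , l<i , x∈l = inj₂ (⋃<-intro {γ} I≲κ A (<-transitive l<i i<j) x∈l)
      vol-B : ∀ i → vol (B i) ≤ y
      vol-B i = vol-∪-below (A i) (λ F → bound (i ∷ F)) (wellFounded i)

  open FiniteUnions using (vol-⋃≤)

  vol-⋃ₗ≤ : ∀ {I : Set ℓ} (A : I → Measurable) {η} → (∀ i → vol (A i) ≤ η) →
            ∀ F → vol (⋃ₗ A F) ≤ length F · η
  vol-⋃ₗ≤ A A≤η []      = vol-∅
  vol-⋃ₗ≤ A A≤η (i ∷ F) = ≤-trans (vol-subadditive {A i} {⋃ₗ A F} id)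
                                  (+-mono-≤ (A≤η i) (vol-⋃ₗ≤ A A≤η F))

  Null : Measurable → Set ℓ₂
  Null A = vol A ≤ 0#

  ·-zero : ∀ n → n · 0# ≤ 0#
  ·-zero zero    = ≤-refl
  ·-zero (suc n) = ≤-trans (reflexive (identityˡ _)) (·-zero n)

  -- Finite subunions are bounded by multiples of `0#`, so the bound `0#` passes to the whole union.
  null-⋃ : ∀ {I : Set ℓ} → I ≲ κ → (A : I → Measurable) → (∀ i → Null (A i)) →
           ∀ {B} → (∀ {x} → x ∈ₛ B → ∃[ i ] x ∈ₛ A i) → Null B
  null-⋃ I≲κ A null {B} B⊆ = ≤-trans (vol-mono {B} {⋃ₛ I≲κ A} B⊆)
    (vol-⋃≤ I≲κ A λ F → ≤-trans (vol-⋃ₗ≤ A null F) (·-zero (length F)))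

  I : Set ℓ
  I = proj₁ weight≤

  I≲κ : I ≲ κ
  I≲κ = proj₁ (proj₂ weight≤)

  base : I → Pred Y ℓ
  base = proj₁ (proj₂ (proj₂ weight≤))

  isBasis : IsBasis τ base
  isBasis = proj₂ (proj₂ (proj₂ weight≤))

  baseₛ : I → Measurable
  baseₛ i = base i , contains _ (proj₁ isBasis i)

  -- Small open covers for a continuous measure.

  module Continuous (continuous : Measure⁺.IsContinuous m) where

    -- A local basis at x that is indexed by the whole of I.
    local : Y → I → Pred Y ℓ
    local x i with em {P = x ∈ base i}
    ... | yes _ = base i
    ... | no _  = U

    local∈τ : ∀ x i → local x i ∈ τ
    local∈τ x i with em {P = x ∈ base i}
    ... | yes _ = proj₁ isBasis i
    ... | no _  = U∈

    ∈local : ∀ x i → x ∈ local x i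
    ∈local x i with em {P = x ∈ base i}
    ... | yes x∈ = x∈
    ... | no _   = _

    local⊆base : ∀ {x i} → x ∈ base i → local x i ⊆ base i
    local⊆base {x} {i} x∈ y∈ with em {P = x ∈ base i}
    ... | yes _ = y∈
    ... | no x∉ = ⊥-elim (x∉ x∈)

    local-isLocalBasis : ∀ x → IsLocalBasis τ x (local x)
    local-isLocalBasis x = (λ i → local∈τ x i , ∈local x i) , refine
      where
      refine : ∀ V → V ∈ τ → x ∈ V → ∃[ i ] local x i ⊆ V
      refine V V∈ x∈V with proj₂ isBasis V x V∈ x∈V
      ... | i , x∈i , i⊆V = i , i⊆V ∘ local⊆base x∈i

    -- Otherwise `y` would be a lower bound along a local basis at `x`, whose infimum is 0 by (M5)
    -- and continuity.
    small-base : ∀ x {y} → ¬ y ≤ 0# → ∃[ i ] x ∈ base i × ¬ y ≤ vol (baseₛ i)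
    small-base x {y} y≰0 = dne λ none →
      y≰0 (≤-trans (infimum y (lower-bound none)) (reflexive (proj₂ (continuous x))))
      where
      infimum : ∀ y → _ → y ≤ _
      infimum = proj₂ (μ-｛｝ x (proj₁ (continuous x)) (Zermelo.wellOrder em ext I) I≲κ
                 (local x) (local∈τ x) (local-isLocalBasis x))
      localₛ : I → Measurable
      localₛ i = local x i , contains _ (local∈τ x i)
      lower-bound : ¬ (∃[ i ] x ∈ base i × ¬ y ≤ vol (baseₛ i)) → ∀ i → y ≤ vol (localₛ i)
      -- The default value `U` of `local` also contains a basic neighbourhood of `x`.
      lower-bound none i with proj₂ isBasis (local x i) x (local∈τ x i) (∈local x i)
      ... | j , x∈j , j⊆ = ≤-trans (dne λ y≰ → none (j , x∈j , y≰))
                                   (vol-mono {baseₛ j} {localₛ i} j⊆)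

    abstract
      -- Basic sets that are too large become empty, which keeps `I` as the index set.
      cover : ∀ {y} → ¬ y ≤ 0# → I → Measurable
      cover {y} _ i with em {P = y ≤ vol (baseₛ i)}
      ... | yes _ = ∅ₛ
      ... | no _  = baseₛ i

      cover-small : ∀ {y} (y≰0 : ¬ y ≤ 0#) i → ¬ y ≤ vol (cover y≰0 i)
      cover-small {y} y≰0 i with em {P = y ≤ vol (baseₛ i)}
      ... | yes _ = λ y≤ → y≰0 (≤-trans y≤ vol-∅)
      ... | no y≰ = y≰

      covers : ∀ {y} (y≰0 : ¬ y ≤ 0#) x → ∃[ i ] x ∈ₛ cover y≰0 i
      covers {y} y≰0 x with small-base x y≰0
      ... | i , x∈ , y≰ = i , x∈cover
        where
        x∈cover : x ∈ₛ cover y≰0 i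
        x∈cover with em {P = y ≤ vol (baseₛ i)}
        ... | yes y≤ = ⊥-elim (y≰ y≤)
        ... | no _   = x∈

    abstract
      -- The small cover cuts `A` into at most `κ` pieces, which cannot all be null.
      small-part : ∀ A → ¬ Null A → ∀ {y} → ¬ y ≤ 0# →
                   Σ[ B ∈ Measurable ] B ⊆ₛ A × ¬ Null B × ¬ y ≤ vol B
      small-part A A≰0 {y} y≰0 = part (dne λ none →
          A≰0 (null-⋃ I≲κ piece (λ i → dne λ p → none (i , p)) A⊆))
        where
        piece : I → Measurable
        piece i = A ∩ₛ cover y≰0 i
        A⊆ : ∀ {x} → x ∈ₛ A → ∃[ i ] x ∈ₛ piece i
        A⊆ {x} x∈A with covers y≰0 x
        ... | i , x∈i = i , x∈A , x∈i
        part : ∃[ i ] ¬ Null (piece i) → Σ[ B ∈ Measurable ] B ⊆ₛ A × ¬ Null B × ¬ y ≤ vol B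
        part (i , p) = piece i , proj₁ , p ,
          λ y≤ → cover-small y≰0 i (≤-trans y≤ (vol-mono {piece i} {cover y≰0 i} proj₂))

    -- If every multiple of η were at most vol Z, finite unions of the cover by sets of
    -- volume below η would be too, and so would the whole space.
    archimedean : ∀ Z → ¬ vol Uₛ ≤ vol Z → ∀ {η} → ¬ η ≤ 0# → ∃[ n ] ¬ n · η ≤ vol Z
    archimedean Z U≰Z {η} η≰0 = dne λ none → U≰Z (≤-trans
      (vol-mono {Uₛ} {⋃ₛ I≲κ (cover η≰0)} λ {x} _ → covers η≰0 x)
      (vol-⋃≤ I≲κ (cover η≰0) λ F → ≤-trans
        (vol-⋃ₗ≤ (cover η≰0) (λ i → ≰⇒≤ (cover-small η≰0 i)) F)
        (dne λ p → none (length F , p))))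

    -- Coinitial sequences and greedy exhaustion in an archimedean set.

    module SmallSet (Z : Measurable) (Z≰0 : ¬ Null Z)
                    (bounded : ∀ {η} → ¬ η ≤ 0# → ∃[ n ] ¬ n · η ≤ vol Z) where

      shrinking : ℕ → Σ[ A ∈ Measurable ] ¬ Null A
      shrinking zero = Z , Z≰0
      shrinking (suc k) with shrinking k
      -- The threshold is `vol A` itself, so volumes strictly decrease.
      ... | A , A≰0 with small-part A A≰0 A≰0
      ...   | B , _ , B≰0 , _ = B , B≰0

      shrinking-⊆ : ∀ k → proj₁ (shrinking (suc k)) ⊆ₛ proj₁ (shrinking k)
      shrinking-⊆ k with shrinking k
      ... | A , A≰0 = proj₁ (proj₂ (small-part A A≰0 A≰0))

      shrinking-< : ∀ k → ¬ vol (proj₁ (shrinking k)) ≤ vol (proj₁ (shrinking (suc k)))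
      shrinking-< k with shrinking k
      ... | A , A≰0 = proj₂ (proj₂ (proj₂ (small-part A A≰0 A≰0)))

      layer : ℕ → Measurable
      layer k = proj₁ (shrinking k) ∖ₛ proj₁ (shrinking (suc k))

      ε : ℕ → Carrier
      ε k = vol (layer k)

      -- A null layer could be dropped by subadditivity, against the strict decrease.
      ε≰0 : ∀ k → ¬ ε k ≤ 0#
      ε≰0 k ε≤0 = shrinking-< k (≤-trans (vol-subadditive {B} {layer k} {A} split)
        (≤-trans (+-mono-≤ ≤-refl ε≤0) (reflexive (identityʳ _))))
        where
        A = proj₁ (shrinking k)
        B = proj₁ (shrinking (suc k))
        split : A ⊆ₛ B ∪ₛ layer k
        split {x} x∈A with em {P = x ∈ₛ B}
        ... | yes x∈B = inj₁ x∈B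
        ... | no x∉B  = inj₂ (x∈A , x∉B)

      -- From the `k`-th set on, `n` successive layers are disjoint, each of volume at least `η`.
      multiples≤ : ∀ {η} → (∀ k → η ≤ ε k) → ∀ n k → n · η ≤ vol (proj₁ (shrinking k))
      multiples≤ η≤ε zero    k = 0-minimum _
      multiples≤ η≤ε (suc n) k = ≤-trans (+-mono-≤ (η≤ε k) (multiples≤ η≤ε n (suc k)))
        (vol-superadditive {layer k} {proj₁ (shrinking (suc k))} {proj₁ (shrinking k)}
          (λ ((_ , x∉) , x∈) → x∉ x∈) proj₁ (shrinking-⊆ k))

      ε-coinitial : ∀ {η} → ¬ η ≤ 0# → ∃[ k ] ¬ η ≤ ε k
      ε-coinitial η≰0 with bounded η≰0
      ... | n , nη≰Z = dne λ none → nη≰Z (multiples≤ (λ k → dne λ p → none (k , p)) n zero)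

      ⋃ₗ-⊆ : ∀ {J : Set ℓ} (A : J → Measurable) → (∀ j → A j ⊆ₛ Z) → ∀ F → ⋃ₗ A F ⊆ₛ Z
      ⋃ₗ-⊆ A A⊆Z (j ∷ F) = [ A⊆Z j , ⋃ₗ-⊆ A A⊆Z F ]′

      Exhausts : {J : Set ℓ} → (J → Measurable) → Carrier → List J → Set (ℓ ⊔ ℓ₂)
      Exhausts A η F = ∀ j → ¬ η ≤ vol (A j ∖ₛ ⋃ₗ A F)

      abstract
        -- Each greedy step adds volume at least `η` inside `Z`; by `bounded` this cannot happen `n`
        -- times.
        exhaust : ∀ {J : Set ℓ} (A : J → Measurable) → (∀ j → A j ⊆ₛ Z) → ∀ {η} → ¬ η ≤ 0# →
                  ∃[ F ] Exhausts A η F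
        exhaust A A⊆Z {η} η≰0 with bounded η≰0
        ... | n , nη≰Z = [ id , (λ (F , nη≤) → ⊥-elim (nη≰Z (≤-trans nη≤
                             (vol-mono {⋃ₗ A F} {Z} (⋃ₗ-⊆ A A⊆Z F))))) ]′ (greedy n)
          where
          greedy : ∀ n → (∃[ F ] Exhausts A η F) ⊎ (∃[ F ] n · η ≤ vol (⋃ₗ A F))
          greedy zero = inj₂ ([] , 0-minimum _)
          greedy (suc n) with greedy n
          ... | inj₁ done = inj₁ done
          ... | inj₂ (F , nη≤) with em {P = ∃[ j ] η ≤ vol (A j ∖ₛ ⋃ₗ A F)}
          ...   | no none = inj₁ (F , λ j p → none (j , p))
          ...   | yes (j , η≤) = inj₂ (j ∷ F , ≤-trans (+-mono-≤ η≤ nη≤)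
                    (vol-superadditive {A j ∖ₛ ⋃ₗ A F} {⋃ₗ A F} {⋃ₗ A (j ∷ F)}
                      (λ ((_ , x∉) , x∈) → x∉ x∈) (inj₁ ∘ proj₁) inj₂))

      -- A triple holds the cell size `k`, the tolerance `l` and a position in the resulting list.
      Index : Set ℓ
      Index = Lift ℓ (ℕ × ℕ × ℕ)

      -- The empty set past the end adds no points and is below every positive threshold.
      nth : {J : Set ℓ} → (J → Measurable) → List J → ℕ → Measurable
      nth A []      _       = ∅ₛ
      nth A (j ∷ F) zero    = A j
      nth A (j ∷ F) (suc p) = nth A F p

      ⋃ₗ⇒nth : {J : Set ℓ} (A : J → Measurable) → ∀ F {x} → x ∈ₛ ⋃ₗ A F → ∃[ p ] x ∈ₛ nth A F p
      ⋃ₗ⇒nth A (j ∷ F) (inj₁ x∈) = zero , x∈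
      ⋃ₗ⇒nth A (j ∷ F) (inj₂ x∈) with ⋃ₗ⇒nth A F x∈
      ... | p , x∈p = suc p , x∈p

      nth-small : {J : Set ℓ} (A : J → Measurable) → ∀ {η} → ¬ η ≤ 0# → (∀ j → ¬ η ≤ vol (A j)) →
                  ∀ F p → ¬ η ≤ vol (nth A F p)
      nth-small A η≰0 small []      p       = λ η≤ → η≰0 (≤-trans η≤ vol-∅)
      nth-small A η≰0 small (j ∷ F) zero    = small j
      nth-small A η≰0 small (j ∷ F) (suc p) = nth-small A η≰0 small F p

      -- Atoms of the countable family of listed cells.

      module Atoms (ε : ℕ → Carrier) (ε≰0 : ∀ k → ¬ ε k ≤ 0#)
                   (ε-coinitial : ∀ {η} → ¬ η ≤ 0# → ∃[ k ] ¬ η ≤ ε k)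
                   (Index≲κ : Index ≲ κ) (2^Index≲κ : (Index → Bool) ≲ κ) where

        cell : ℕ → I → Measurable
        cell k i = Z ∩ₛ cover (ε≰0 k) i

        cell-small : ∀ k i → ¬ ε k ≤ vol (cell k i)
        cell-small k i ε≤ = cover-small (ε≰0 k) i
          (≤-trans ε≤ (vol-mono {cell k i} {cover (ε≰0 k) i} proj₂))

        exhaust-cell : ∀ k l → ∃[ F ] Exhausts (cell k) (ε l) F
        exhaust-cell k l = exhaust (cell k) (λ _ → proj₁) (ε≰0 l)

        list : ℕ → ℕ → List I
        list k l = proj₁ (exhaust-cell k l)

        generator : Index → Measurable
        generator (lift (k , l , p)) = nth (cell k) (list k l) p

        listed : ℕ → Measurable
        listed k = ⋃ₛ (ℕ≲κ ↣-∘ mk↣ {to = lower {ℓ = ℓ}} (cong lift))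
                      (λ (lift l) → ⋃ₗ (cell k) (list k l))

        residue : ℕ → Measurable
        residue k = Z ∖ₛ listed k

        -- What remains of each cell is below every `ε l`, hence null by coinitiality, and at most
        -- `κ` cells cover `Z`.
        residue-null : ∀ k → Null (residue k)
        residue-null k = null-⋃ I≲κ rest (λ i → dne (not-positive i)) residue⊆
          where
          rest : I → Measurable
          rest i = cell k i ∖ₛ listed k
          not-positive : ∀ i → ¬ ¬ Null (rest i)
          not-positive i p with ε-coinitial p
          ... | l , v≰ε = proj₂ (exhaust-cell k l) i (≤-trans (≰⇒≤ v≰ε)
                (vol-mono {rest i} {cell k i ∖ₛ ⋃ₗ (cell k) (list k l)}
                  λ (x∈ , x∉) → x∈ , λ x∈l → x∉ (lift l , x∈l)))
          residue⊆ : ∀ {x} → x ∈ₛ residue k → ∃[ i ] x ∈ₛ rest i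
          residue⊆ {x} (x∈Z , x∉) with covers (ε≰0 k) x
          ... | i , x∈i = i , (x∈Z , x∈i) , x∉

        signed : Bool → Measurable → Measurable
        signed true  A = A
        signed false A = ∁ₛ A

        atom : (Index → Bool) → Measurable
        atom b = Z ∩ₛ ⋂ₛ Index≲κ (λ t → signed (b t) (generator t))

        atom⊆signed : ∀ b t → atom b ⊆ₛ signed (b t) (generator t)
        atom⊆signed b t (_ , x∈) = x∈ t

        -- A positive atom would exceed or equal some `ε k`. Yet it lies in a listed cell of size
        -- below `ε k` or, avoiding all of these, in the null `residue k`.
        atom-null : ∀ b → Null (atom b)
        atom-null b = dne not-positive
          where
          not-positive : ¬ ¬ Null (atom b)
          not-positive p with ε-coinitial p
          ... | k , v≰ε with em {P = ∃[ l ] ∃[ q ] b (lift (k , l , q)) ≡ true}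
          ...   | yes (l , q , eq) =
                  nth-small (cell k) (ε≰0 k) (cell-small k) (list k l) q (≤-trans (≰⇒≤ v≰ε)
                    (vol-mono {atom b} {generator (lift (k , l , q))} λ {x} x∈ →
                      subst (λ s → x ∈ₛ signed s (generator (lift (k , l , q)))) eq
                            (atom⊆signed b _ x∈)))
          ...   | no none = p (≤-trans (vol-mono {atom b} {residue k} atom⊆residue) (residue-null k))
            where
            atom⊆residue : atom b ⊆ₛ residue k
            atom⊆residue {x} x∈ = proj₁ x∈ , λ (lift l , x∈l) → outside l (⋃ₗ⇒nth (cell k) (list k l) x∈l)
              where
              outside : ∀ l → ¬ (∃[ q ] x ∈ₛ generator (lift (k , l , q)))
              outside l (q , x∈q) with b (lift (k , l , q)) in eq | atom⊆signed b (lift (k , l , q)) x∈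
              ... | true  | _  = none (l , q , eq)
              ... | false | x∉ = x∉ x∈q

        Z-null : Null Z
        Z-null = null-⋃ 2^Index≲κ atom atom-null λ {x} x∈Z → address x , x∈Z , in-signed x
          where
          address : Y → Index → Bool
          address x t = does (em {P = x ∈ₛ generator t})
          in-signed : ∀ x t → x ∈ₛ signed (address x t) (generator t)
          in-signed x t with em {P = x ∈ₛ generator t}
          ... | yes x∈ = x∈
          ... | no x∉  = x∉

    not-continuous : ¬ (∀ {θ : Set ℓ} → θ ≲ ℕ → (θ → Bool) ≲ κ)
    -- The threshold `vol Uₛ` makes `Z` strictly smaller than the space, as `archimedean` requires.
    not-continuous 2^≲κ with small-part Uₛ vol-U vol-U
    ... | Z , _ , Z≰0 , U≰Z = Z≰0 Z-null
      where
      open SmallSet Z Z≰0 (archimedean Z U≰Z)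
      open Atoms ε ε≰0 ε-coinitial (ℕ≲κ ↣-∘ ℕ³≲ℕ) (2^≲κ ℕ³≲ℕ)

corollary8p11 : (∀ {a} → ExcludedMiddle a) →
    (∀ {a b} → Extensionality a b) →
    ∀ {ℓ c ℓ₁ ℓ₂} (κ : Set ℓ) → 2^< κ ≣ κ → ℕ ⋦ κ →
    ∀ {Y : Set ℓ} (τ 𝔐 : Family Y) (borel : IsBorelSpace⁺ κ τ 𝔐)
    (𝕊 : PosTotallyOrderedMonoid c ℓ₁ ℓ₂) (𝕊um : InfinitarySum 𝕊 ℓ) →
    ¬ (Σ[ m ∈ Measure⁺ κ (IsBorelSpace⁺.contains borel) 𝕊 𝕊um ] Measure⁺.IsContinuous m)
corollary8p11 em ext κ 2^<κ≣κ (ℕ≲κ , κ≴ℕ) τ 𝔐 borel 𝕊 𝕊um (m , continuous) =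
  -- A countable `θ` is strictly below `κ`, or `κ` would embed into `ℕ`; so `θ → Bool` is among the
  -- powers bounded by `κ`.
  not-continuous λ {θ} θ≲ℕ → proj₁ 2^<κ≣κ (θ , ℕ≲κ ↣-∘ θ≲ℕ , λ κ≲θ → κ≴ℕ (θ≲ℕ ↣-∘ κ≲θ))
  where
  open Measure em ext ℕ≲κ borel m
  open Continuous continuous
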